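{- Let $n \in \mathbb{N}$ (a positive integer) be divisible by $18$. Then there is an oriented graph $G$ on $n$ vertices with $\delta^0(G) = 7n/18 - 1$ which does not contain a perfect $T_3$-packing.
   Context: Digraphs have no loops and have at most one edge in each direction between any pair of vertices. An oriented graph is a digraph containing no 2-cycle, i.e. there is at most one directed edge between any pair of distinct vertices. For a digraph $G$, the minimum semidegree $\delta^0(G)$ is the minimum of its minimum outdegree $\delta^+(G)$ and its minimum indegree $\delta^-(G)$. $T_3$ denotes the transitive triangle, i.e. the transitive tournament on $3$ vertices. Given an oriented graph $H$, a perfect $H$-packing in an oriented graph $G$ is a collection of vertex-disjoint copies of $H$ in $G$ (as not necessarily induced subgraphs) which covers all the vertices of $G$. -}

module Defs where

open import Data.Fin using (Fin; _<_)
open import Data.Fin.Properties using (_<?_; <-irrefl; <-asym)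
open import Data.List using (length; map; filter; allFin)
open import Data.List.Extrema.Nat using (min)
open import Data.Nat using (ℕ; _⊓_)
open import Data.Product using (∃₂)
open import Function.Definitions using (Injective)
open import Level using (0ℓ)
open import Relation.Binary.Core using (Rel)
open import Relation.Binary.Definitions using (Decidable; Irreflexive; Asymmetric)
open import Relation.Binary.PropositionalEquality using (_≡_)

-- A relation only records whether there is an edge from x to y, so there is
-- at most one edge in each direction.  Decidability makes degrees computable.
record Digraph (n : ℕ) : Set₁ where
  infix 4 _⟶_ _⟶?_
  field
    _⟶_      : Rel (Fin n) 0ℓ
    _⟶?_     : Decidable _⟶_
    loopless : Irreflexive _≡_ _⟶_

record OrientedGraph (n : ℕ) : Set₁ where
  field
    digraph    : Digraph n
  open Digraph digraph public
  field
    no-2-cycle : Asymmetric _⟶_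

module _ {n : ℕ} (G : Digraph n) where
  open Digraph G

  outdegree : Fin n → ℕ
  outdegree x = length (filter (λ y → x ⟶? y) (allFin n))

  indegree : Fin n → ℕ
  indegree x = length (filter (λ y → y ⟶? x) (allFin n))

  -- The first argument of min takes part in the minimum.  Degrees are at most
  -- n, so the value n changes nothing as long as there is a vertex.
  δ⁺ : ℕ
  δ⁺ = min n (map outdegree (allFin n))

  δ⁻ : ℕ
  δ⁻ = min n (map indegree (allFin n))

  δ⁰ : ℕ
  δ⁰ = δ⁺ ⊓ δ⁻

transitiveTournament : ∀ k → OrientedGraph k
transitiveTournament k = record
  { digraph = record
    { _⟶_      = _<_
    ; _⟶?_     = _<?_
    ; loopless = <-irrefl
    }
  ; no-2-cycle = <-asym
  }

T₃ : OrientedGraph 3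
T₃ = transitiveTournament 3

-- A copy of H in G, given by the way H is placed in G.  Non-edges of H need not
-- be sent to non-edges of G: copies need not be induced.
record Copy {h n : ℕ} (H : OrientedGraph h) (G : OrientedGraph n) : Set where
  private
    module H = OrientedGraph H
    module G = OrientedGraph G
  field
    vertex    : Fin h → Fin n
    injective : Injective _≡_ _≡_ vertex
    edge      : ∀ {x y} → x H.⟶ y → vertex x G.⟶ vertex y

record PerfectPacking {h n : ℕ} (H : OrientedGraph h) (G : OrientedGraph n) : Set where
  open Copy using (vertex)
  field
    size     : ℕ
    copy     : Fin size → Copy H G
    disjoint : ∀ {i j x y} → vertex (copy i) x ≡ vertex (copy j) y → i ≡ j
    covers   : ∀ v → ∃₂ λ i x → vertex (copy i) x ≡ v

{-# OPTIONS --safe #-}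
-- Start from an oriented graph on 18 vertices, A of size 6 and B of size 12, in
-- which every semidegree is at least 7 and B spans no transitive triangle (it is
-- a blow-up of a directed 3-cycle).  Blow every vertex up by k = n / 18, and move one
-- vertex from A to B.  Degrees drop by at most one, and A now has 6 k − 1
-- vertices.  Every transitive triangle meets A, so disjoint ones number at most
-- 6 k − 1, whereas a perfect packing needs 6 k of them.
module Submission where

open import Defs
open import Data.Bool using (Bool; true; false; not; T)
open import Data.Bool.Properties using (T?)
open import Data.Fin using (Fin; zero; suc; #_; toℕ; fromℕ<; _↑ˡ_; _↑ʳ_; combine; remQuot; quotient; remainder)
open import Data.Fin.Properties using
  (all?; toℕ-injective; fromℕ<-injective; combine-injective; combine-remQuot; splitAt-↑ˡ; splitAt-↑ʳ; injective⇒≤)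
open import Data.List using ([]; _∷_; length; map; filter; tabulate; allFin)
open import Data.List.Extrema.Nat using (min≤v⁺; v≤min⁺)
open import Data.List.Membership.Propositional using (lose)
open import Data.List.Membership.Propositional.Properties using (∈-map⁺; ∈-allFin)
open import Data.List.Properties using
  (length-filter; length-tabulate; tabulate-cong; filter-accept; filter-reject; map-tabulate)
import Data.List.Relation.Unary.All.Properties as All
open import Data.Nat using
  (ℕ; zero; suc; NonZero; _+_; _*_; _∸_; _/_; _%_; _≡ᵇ_; _<ᵇ_; _<_; _≤_; _≤?_; pred; z<s; s<s; s≤s; ≢-nonZero⁻¹)
open import Data.Nat.DivMod using (m*n/n≡m)
open import Data.Nat.Divisibility using (_∣_; divides)
open import Data.Nat.Properties using
  (≤-refl; ≤-reflexive; ≤-trans; ≤-antisym; n≤1+n; 1+n≰n; *-monoˡ-≤; *-assoc; *-comm; *-cancelʳ-≤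
  ; ⊓-glb; m⊓n≤m; ∸-monoˡ-≤; <ᵇ⇒<; module ≤-Reasoning)
open import Data.Product using (Σ-syntax; ∃-syntax; _×_; _,_; proj₁; proj₂; uncurry)
open import Data.Sum using (_⊎_; inj₂; [_,_]′)
open import Function using (_∘_; id)
open import Function.Definitions using (Injective)
open import Level using (0ℓ)
open import Relation.Binary.PropositionalEquality using
  (_≡_; _≢_; refl; sym; trans; cong; cong₂; subst; module ≡-Reasoning)
open import Relation.Nullary using (¬_; does; contradiction)
open import Relation.Nullary.Decidable using (from-yes; ¬?; _→-dec_; _⊎-dec_)
open import Relation.Unary using (Pred; Decidable)

δ⁰-unique : ∀ {n d} (G : Digraph n) → (∀ v → d ≤ outdegree G v) → (∀ v → d ≤ indegree G v) →
  ∀ v → outdegree G v ≡ d → δ⁰ G ≡ d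
δ⁰-unique {n} {d} G d≤out d≤in v refl = ≤-antisym
  (≤-trans (m⊓n≤m (δ⁺ G) (δ⁻ G))
    (min≤v⁺ n (map (outdegree G) (allFin n)) (inj₂ (lose (∈-map⁺ (outdegree G) (∈-allFin v)) ≤-refl))))
  (⊓-glb (v≤min⁺ d≤n (All.map⁺ (All.tabulate⁺ d≤out)))
         (v≤min⁺ d≤n (All.map⁺ (All.tabulate⁺ d≤in))))
  where
  -- The default `n` takes part in both minima, so `d` must not exceed it; it does not, because `d`
  -- is the outdegree of `v`.
  d≤n : d ≤ n
  d≤n = ≤-trans (length-filter (Digraph._⟶?_ G v) (allFin n)) (≤-reflexive (length-tabulate {n = n} id))

module _ {h n : ℕ} {H : OrientedGraph h} {G : OrientedGraph n} (packing : PerfectPacking H G) where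
  open PerfectPacking packing
  open Copy using (vertex)

  -- Each vertex is encoded by a copy covering it and its place in that copy; this pair recovers the
  -- vertex.
  packing-order : n ≤ size * h
  packing-order = injective⇒≤ position-injective
    where
    position : Fin n → Fin (size * h)
    position v = let i , x , _ = covers v in combine i x

    position-injective : Injective _≡_ _≡_ position
    position-injective {u} {v} eq
      with i , x , refl ← covers u | j , y , refl ← covers v
      with refl , refl ← combine-injective i x j y eq = refl

module _ {A : Set} {P : Pred A 0ℓ} (P? : Decidable P) where

  count : ∀ {n} → (Fin n → A) → ℕ
  count f = length (filter P? (tabulate f))

  count-cong : ∀ {n} {f g : Fin n → A} → (∀ i → f i ≡ g i) → count f ≡ count g
  count-cong f≗g = cong (length ∘ filter P?) (tabulate-cong f≗g)

  count-+ : ∀ m {n} (f : Fin (m + n) → A) → count f ≡ count (f ∘ (_↑ˡ n)) + count (f ∘ (m ↑ʳ_))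
  count-+ zero    f = refl
  count-+ (suc m) f with does (P? (f zero))
  ... | true  = cong suc (count-+ m (f ∘ suc))
  ... | false = count-+ m (f ∘ suc)

  -- The remainder runs through `Fin n` once per block of length `n`; the induction splits off the
  -- first block.
  count-remainder : ∀ k {n} (f : Fin n → A) → count (f ∘ remainder {k} n) ≡ k * count f
  count-remainder zero        f = refl
  count-remainder (suc k) {n} f = begin
    count (f ∘ remainder {suc k} n)
      ≡⟨ count-+ n (f ∘ remainder {suc k} n) ⟩
    count (f ∘ remainder {suc k} n ∘ (_↑ˡ k * n)) + count (f ∘ remainder {suc k} n ∘ (n ↑ʳ_))
      ≡⟨ cong₂ _+_ (count-cong (cong f ∘ remainder-↑ˡ)) (count-cong (cong f ∘ remainder-↑ʳ)) ⟩
    count f + count (f ∘ remainder {k} n)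
      ≡⟨ cong (count f +_) (count-remainder k f) ⟩
    count f + k * count f
      ∎
    where
    open ≡-Reasoning
    remainder-↑ˡ : ∀ i → remainder {suc k} n (i ↑ˡ k * n) ≡ i
    remainder-↑ˡ i rewrite splitAt-↑ˡ n i (k * n) = refl

    remainder-↑ʳ : ∀ i → remainder {suc k} n (n ↑ʳ i) ≡ remainder {k} n i
    remainder-↑ʳ i rewrite splitAt-↑ʳ n (k * n) i = refl

  count-suc-≤ : ∀ {n} (f : Fin (suc n) → A) → count (f ∘ suc) ≤ count f
  count-suc-≤ f with does (P? (f zero))
  ... | true  = n≤1+n _
  ... | false = ≤-refl

  count-≤-suc : ∀ {n} (f : Fin (suc n) → A) → count f ≤ suc (count (f ∘ suc))
  count-≤-suc f with does (P? (f zero))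
  ... | true  = ≤-refl
  ... | false = n≤1+n _

  length-filter-∘ : ∀ {B : Set} (g : B → A) xs →
    length (filter (λ x → P? (g x)) xs) ≡ length (filter P? (map g xs))
  length-filter-∘ g []       = refl
  length-filter-∘ g (x ∷ xs) with does (P? (g x))
  ... | true  = cong suc (length-filter-∘ g xs)
  ... | false = length-filter-∘ g xs

  -- Degrees filter vertices, `count` filters their images. With `class k` as `g`, a degree becomes
  -- a count of classes.
  length-filter-allFin : ∀ {n} (g : Fin n → A) → length (filter (λ x → P? (g x)) (allFin n)) ≡ count g
  length-filter-allFin {n} g =
    trans (length-filter-∘ g (allFin n)) (cong (length ∘ filter P?) (map-tabulate id g))

-- Quotient and remainder determine each value of `f`, and remainders below `l` leave only `k * l`
-- such pairs.
small-remainder⇒≤ : ∀ {m k l} n (f : Fin m → Fin (k * n)) → Injective _≡_ _≡_ f →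
  (∀ i → toℕ (remainder {k} n (f i)) < l) → m ≤ k * l
small-remainder⇒≤ {m} {k} {l} n f f-injective small = injective⇒≤ g-injective
  where
  g : Fin m → Fin (k * l)
  g i = combine (quotient {k} n (f i)) (fromℕ< (small i))

  g-injective : Injective _≡_ _≡_ g
  g-injective {i} {j} eq
    with q≡ , r≡ ← combine-injective {k} (quotient n (f i)) _ (quotient n (f j)) _ eq = f-injective (begin
    f i                                   ≡⟨ combine-remQuot {k} n (f i) ⟨
    uncurry combine (remQuot {k} n (f i)) ≡⟨ cong₂ combine q≡ (toℕ-injective (fromℕ<-injective _ _ (small i) (small j) r≡)) ⟩
    uncurry combine (remQuot {k} n (f j)) ≡⟨ combine-remQuot {k} n (f j) ⟩
    f j                                   ∎)
    where open ≡-Reasoning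

-- `A` takes the first six numbers, so that lying over `A` in the blow-up is a bound on the
-- remainder.
inA : Fin 18 → Bool
inA i = toℕ i <ᵇ 6

-- Residues modulo 3 orient A and B cyclically, residues modulo 2 orient the
-- edges between A and B as a blow-up of a directed 4-cycle.
arc : Fin 18 → Fin 18 → Bool
arc i j with inA i | inA j
... | true  | true  = (1 + toℕ i) % 3 ≡ᵇ toℕ j % 3
... | false | false = (1 + toℕ i) % 3 ≡ᵇ toℕ j % 3
... | true  | false = toℕ i % 2 ≡ᵇ toℕ j % 2
... | false | true  = not (toℕ i % 2 ≡ᵇ toℕ j % 2)

arc-irreflexive : ∀ i → ¬ T (arc i i)
arc-irreflexive = from-yes (all? λ i → ¬? (T? (arc i i)))

arc-asymmetric : ∀ i j → T (arc i j) → ¬ T (arc j i)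
arc-asymmetric = from-yes (all? λ i → all? λ j → T? (arc i j) →-dec ¬? (T? (arc j i)))

-- The minimum is attained in B: a vertex of B has 4 out-neighbours in B and 3 in A, one of A has 2
-- in A and 6 in B. Indegrees split in the same way.
arc-outdegree : ∀ i → 7 ≤ count (λ j → T? (arc i j)) id
arc-outdegree = from-yes (all? λ i → 7 ≤? count (λ j → T? (arc i j)) id)

arc-indegree : ∀ i → 7 ≤ count (λ j → T? (arc j i)) id
arc-indegree = from-yes (all? λ i → 7 ≤? count (λ j → T? (arc j i)) id)

-- Arcs inside B raise the residue modulo 3 by one, so two in a row end two residues ahead, and from
-- there the arcs lead back to the start.
transitive-triangle-meets-A : ∀ i j l → T (arc i j) → T (arc j l) → T (arc i l) →
  T (inA i) ⊎ T (inA j) ⊎ T (inA l)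
transitive-triangle-meets-A = from-yes (all? λ i → all? λ j → all? λ l →
  T? (arc i j) →-dec T? (arc j l) →-dec T? (arc i l) →-dec
  (T? (inA i) ⊎-dec T? (inA j) ⊎-dec T? (inA l)))

-- Vertex 0, a copy of 0 in A, is turned into a copy of 7 in B.  As 7 has an arc
-- to 0 but not to itself, copies of 7 end up with outdegree exactly 7 (k + 1) − 1.
class : ∀ k → Fin (suc k * 18) → Fin 18
class k zero    = # 7
class k (suc v) = remainder {suc k} 18 (suc v)

module _ {P : Pred (Fin 18) 0ℓ} (P? : Decidable P) where
  open ≤-Reasoning

  count-class-≥ : ∀ k → 7 ≤ count P? id → 7 * suc k ∸ 1 ≤ count P? (class k)
  count-class-≥ k 7≤ = ∸-monoˡ-≤ 1 (begin
    7 * suc k                                     ≤⟨ *-monoˡ-≤ (suc k) 7≤ ⟩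
    count P? id * suc k                           ≡⟨ *-comm (count P? id) (suc k) ⟩
    suc k * count P? id                           ≡⟨ count-remainder P? (suc k) id ⟨
    -- `class k` differs from the remainder only at vertex 0; discarding that vertex and restoring
    -- it as a copy of 7 loses at most one.
    count P? (remainder {suc k} 18)               ≤⟨ count-≤-suc P? (remainder {suc k} 18) ⟩
    suc (count P? (class k ∘ suc))                ≤⟨ s≤s (count-suc-≤ P? (class k)) ⟩
    suc (count P? (class k))                      ∎)

  -- Vertex 0 is counted as a copy of 0 but not as a copy of 7, so moving it costs exactly one.
  count-class-exact : ∀ k → P (# 0) → ¬ P (# 7) → count P? id ≡ 7 → count P? (class k) ≡ 7 * suc k ∸ 1
  count-class-exact k P0 ¬P7 ≡7 = cong pred (begin-equality
    suc (count P? (class k))                      ≡⟨ cong (suc ∘ length) (filter-reject P? ¬P7) ⟩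
    suc (count P? (class k ∘ suc))                ≡⟨ cong length (filter-accept P? P0) ⟨
    count P? (remainder {suc k} 18)               ≡⟨ count-remainder P? (suc k) id ⟩
    suc k * count P? id                           ≡⟨ cong (suc k *_) ≡7 ⟩
    suc k * 7                                     ≡⟨ *-comm (suc k) 7 ⟩
    7 * suc k                                     ∎)

blowUp : ∀ k → OrientedGraph (suc k * 18)
blowUp k = record
  { digraph = record
    { _⟶_      = λ u v → T (arc (class k u) (class k v))
    ; _⟶?_     = λ u v → T? (arc (class k u) (class k v))
    ; loopless = λ { {u} refl → arc-irreflexive (class k u) }
    }
  ; no-2-cycle = λ {u} {v} → arc-asymmetric (class k u) (class k v)
  }

blowUp-outdegree : ∀ k v →
  outdegree (OrientedGraph.digraph (blowUp k)) v ≡ count (λ j → T? (arc (class k v) j)) (class k)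
blowUp-outdegree k v = length-filter-allFin (λ j → T? (arc (class k v) j)) (class k)

blowUp-indegree : ∀ k v →
  indegree (OrientedGraph.digraph (blowUp k)) v ≡ count (λ j → T? (arc j (class k v))) (class k)
blowUp-indegree k v = length-filter-allFin (λ j → T? (arc j (class k v))) (class k)

blowUp-outdegree-≥ : ∀ k v → 7 * suc k ∸ 1 ≤ outdegree (OrientedGraph.digraph (blowUp k)) v
blowUp-outdegree-≥ k v rewrite blowUp-outdegree k v =
  count-class-≥ (λ j → T? (arc (class k v) j)) k (arc-outdegree (class k v))

blowUp-indegree-≥ : ∀ k v → 7 * suc k ∸ 1 ≤ indegree (OrientedGraph.digraph (blowUp k)) v
blowUp-indegree-≥ k v rewrite blowUp-indegree k v =
  count-class-≥ (λ j → T? (arc j (class k v))) k (arc-indegree (class k v))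

blowUp-outdegree-zero : ∀ k → outdegree (OrientedGraph.digraph (blowUp k)) zero ≡ 7 * suc k ∸ 1
blowUp-outdegree-zero k = trans (blowUp-outdegree k zero)
  -- Vertex 0 is itself a copy of 7. Evaluation settles the arc from 7 to 0, the missing loop at 7
  -- and the outdegree 7.
  (count-class-exact (λ j → T? (arc (# 7) j)) k _ id refl)

blowUp-δ⁰ : ∀ k → δ⁰ (OrientedGraph.digraph (blowUp k)) ≡ 7 * suc k ∸ 1
blowUp-δ⁰ k = δ⁰-unique (OrientedGraph.digraph (blowUp k)) (blowUp-outdegree-≥ k) (blowUp-indegree-≥ k)
  zero (blowUp-outdegree-zero k)

-- Covering forces `size` to be at least `suc k * 6`. One vertex of A per copy, together with vertex
-- 0, gives `suc size` distinct vertices of remainder below 6, and only `suc k * 6` exist.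
blowUp-no-packing : ∀ k → ¬ PerfectPacking T₃ (blowUp k)
blowUp-no-packing k packing = 1+n≰n (begin
  suc size  ≤⟨ small-remainder⇒≤ 18 f f-injective f-small ⟩
  suc k * 6 ≤⟨ *-cancelʳ-≤ (suc k * 6) size 3 (≤-trans (≤-reflexive (*-assoc (suc k) 6 3)) (packing-order packing)) ⟩
  size      ∎)
  where
  open ≤-Reasoning
  open PerfectPacking packing
  open Copy

  meets-A : ∀ i → ∃[ x ] T (inA (class k (vertex (copy i) x)))
  meets-A i = [ # 0 ,_ , [ # 1 ,_ , # 2 ,_ ]′ ]′ (transitive-triangle-meets-A (c (# 0)) (c (# 1)) (c (# 2))
    (edge (copy i) z<s) (edge (copy i) (s<s z<s)) (edge (copy i) z<s))
    where
    c : Fin 3 → Fin 18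
    c = class k ∘ vertex (copy i)

  v : Fin size → Fin (suc k * 18)
  v i = vertex (copy i) (proj₁ (meets-A i))

  v-in-A : ∀ i → T (inA (class k (v i)))
  v-in-A i = proj₂ (meets-A i)

  -- Vertex 0 has left A, so it can be added to the chosen vertices of A.
  f : Fin (suc size) → Fin (suc k * 18)
  f zero    = zero
  f (suc i) = v i

  zero≢v : ∀ i → zero ≢ v i
  zero≢v i eq = subst (T ∘ inA ∘ class k) (sym eq) (v-in-A i)

  f-injective : Injective _≡_ _≡_ f
  f-injective {zero}  {zero}  eq = refl
  f-injective {zero}  {suc j} eq = contradiction eq (zero≢v j)
  f-injective {suc i} {zero}  eq = contradiction (sym eq) (zero≢v i)
  f-injective {suc i} {suc j} eq = cong suc (disjoint eq)

  A⇒small : ∀ u → T (inA (class k u)) → toℕ (remainder {suc k} 18 u) < 6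
  -- The case `zero` is empty, since its class 7 lies in B; elsewhere the class is the remainder.
  A⇒small (suc u) = <ᵇ⇒< _ 6

  f-small : ∀ i → toℕ (remainder {suc k} 18 (f i)) < 6
  f-small zero    = z<s
  f-small (suc i) = A⇒small (v i) (v-in-A i)

proposition6 : ∀ (n : ℕ) → .{{_ : NonZero n}} → 18 ∣ n →
    Σ[ G ∈ OrientedGraph n ] (δ⁰ (OrientedGraph.digraph G) ≡ (7 * n) / 18 ∸ 1 × ¬ PerfectPacking T₃ G)
proposition6 n (divides zero refl)    = contradiction refl (≢-nonZero⁻¹ n)
proposition6 n (divides (suc k) refl) =
  blowUp k , trans (blowUp-δ⁰ k) (cong (_∸ 1) (sym 7n/18≡7k)) , blowUp-no-packing k
  where
  7n/18≡7k : (7 * (suc k * 18)) / 18 ≡ 7 * suc k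
  7n/18≡7k = trans (cong (_/ 18) (sym (*-assoc 7 (suc k) 18))) (m*n/n≡m (7 * suc k) 18)
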